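{- Consider the $N$-shaped matching graph with $\alpha>\beta$. For every $\theta\in[0,1)$ the optimal control for the discounted cost problem is of threshold type in $(1,2)$ with priority to $(1,1)$ and $(2,2)$: there exists a decision rule of threshold type in $(1,2)$ with priority to $(1,1)$ and $(2,2)$ (for some fixed threshold $t\in\mathbb N\cup\{\infty\}$) such that the stationary policy $\pi$ using it satisfies $v^\pi_\theta(y)=v^\ast_\theta(y)$ for all $y\in\mathcal Y$.
   Context: $N$-shaped matching model. Demand nodes $\mathcal D=\{d_1,d_2\}$, supply nodes $\mathcal S=\{s_1,s_2\}$, edges $\mathcal E=\{(1,1),(1,2),(2,2)\}$, where $(i,j)$ stands for $(d_i,s_j)$; $(2,1)\notin\mathcal E$. Vectors in $\mathbb N^4$ ($\mathbb N=\{0,1,\dots\}$) are indexed by $(d_1,d_2,s_1,s_2)$, $e_k$ is the unit vector of node $k$ and $e_{(i,j)}=e_{d_i}+e_{s_j}$ for all $i,j\in\{1,2\}$. $\mathcal A=\mathcal D\times\mathcal S$ is the set of arrival pairs, $(i,j)$ being identified with $e_{(i,j)}$. Arrivals are i.i.d., distributed as $A$, with independent demand and supply: the demand item is $d_1$ with probability $\alpha$, $d_2$ with probability $1-\alpha$, the supply item is $s_1$ with probability $\beta$, $s_2$ with probability $1-\beta$, where $\alpha,\beta\in(0,1)$ and $\alpha>\beta$ (stability). States: $\mathcal Q=\{q\in\mathbb N^{4}:q_{d_1}+q_{d_2}=q_{s_1}+q_{s_2}\}$, $\mathcal Y=\mathcal Q\times\mathcal A$. For $x\in\mathcal Q$,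 $U_x$ is the set of $u=u_{(1,1)}e_{(1,1)}+u_{(1,2)}e_{(1,2)}+u_{(2,2)}e_{(2,2)}$ with $u_{(i,j)}\in\mathbb N$, $u_{(1,1)}+u_{(1,2)}\le x_{d_1}$, $u_{(2,2)}\le x_{d_2}$, $u_{(1,1)}\le x_{s_1}$, $u_{(1,2)}+u_{(2,2)}\le x_{s_2}$. Dynamics and costs: a decision rule maps each $x\in\mathcal Q$ to some $u_x\in U_x$. A policy $\pi$ is a sequence of decision rules; it is stationary if the same rule is used at all times. $Y(n)=(Q(n),A(n))$, $X(n)=Q(n)+A(n)$, $Q(n+1)=X(n)-u$ with $u\in U_{X(n)}$ chosen by the rule used at time $n$; $Y(0)=y$. The cost in $y=(q,a)$ is $c(y)=c(x)=\sum_kc_kx_k$, $x=q+a$, a linear function assumed nonnegative on $\mathcal Q$. $v_\theta^\pi(y)=\lim_{N\to\infty}\sum_{n=0}^{N-1}\theta^n\mathbb E_y^\pi[c(Y(n))]$, $v_\theta^\ast(y)=\inf_\pi v_\theta^\pi(y)$ over all policies. Threshold type: a decision rule is of threshold type in $(1,2)$ with priority to $(1,1)$ and $(2,2)$ if for some $t\in\mathbb N\cup\{\infty\}$, for all $x$, $u_x=\min(x_{d_1},x_{s_1})e_{(1,1)}+\min(x_{d_2},x_{s_2})e_{(2,2)}+k_t(x)e_{(1,2)}$, where $k_t(x)=0$ if $x_{d_1}-x_{s_1}\le t$ and $k_t(x)=x_{d_1}-x_{s_1}-t$ otherwise. -}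

module Defs where

open import Algebra.Bundles using (CommutativeRing)
open import Data.Fin.Base using (toℕ)
open import Data.Nat.Base as ℕ using (ℕ; suc; _∸_; _⊓_)
open import Data.Nat.Properties as ℕ using ()
open import Data.Product.Base using (Σ; ∃; _×_; _,_; proj₁)
open import Data.Vec.Base using (Vec; []; _∷_)
open import Level using (0ℓ)
open import Relation.Binary.Core using (Rel)
open import Relation.Binary.PropositionalEquality
  using (_≡_; refl; trans; cong; cong₂; module ≡-Reasoning)
open import Relation.Binary.Structures using (IsTotalOrder)
open import Relation.Nullary using (¬_)
open import Relation.Nullary.Construct.Add.Supremum using (_⁺; [_]; ⊤⁺)
import Algebra.Properties.Monoid.Mult as MonoidMult
import Algebra.Properties.Monoid.Sum as MonoidSum
import Algebra.Properties.Semiring.Exp as SemiringExp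
import Relation.Binary.Construct.NonStrictToStrict as ToStrict

module Bounds {A : Set} (_≤_ : Rel A 0ℓ) where

  UpperBound LowerBound : (A → Set) → A → Set
  UpperBound P b = ∀ x → P x → x ≤ b
  LowerBound P b = ∀ x → P x → b ≤ x

  IsSupremum IsInfimum : (A → Set) → A → Set
  IsSupremum P s = UpperBound P s × (∀ b → UpperBound P b → s ≤ b)
  IsInfimum  P i = LowerBound P i × (∀ b → LowerBound P b → b ≤ i)

-- The library has no real numbers.  ℝ is taken to be any Dedekind-complete
-- ordered field, which classically determines it up to unique isomorphism.
record CompleteOrderedField : Set₁ where
  infix 4 _≤_
  field
    commutativeRing : CommutativeRing 0ℓ 0ℓ

  open CommutativeRing commutativeRing public

  field
    _≤_          : Rel Carrier 0ℓ
    isTotalOrder : IsTotalOrder _≈_ _≤_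
    0≉1          : ¬ (0# ≈ 1#)
    inverse      : ∀ x → ¬ (x ≈ 0#) → ∃ λ y → x * y ≈ 1#
    +-monoˡ-≤    : ∀ z {x y} → x ≤ y → x + z ≤ y + z
    *-nonneg     : ∀ {x y} → 0# ≤ x → 0# ≤ y → 0# ≤ x * y

  open Bounds _≤_ public

  field
    complete : (P : Carrier → Set) → ∃ P → ∃ (UpperBound P) →
               ∃ (IsSupremum P)

  open ToStrict _≈_ _≤_ public using (_<_)

  IsLimit : (ℕ → Carrier) → Carrier → Set
  IsLimit f l = ∀ ε → 0# < ε →
    ∃ λ N₀ → ∀ N → N₀ ℕ.≤ N → (l - ε < f N) × (f N < l + ε)

data Demand : Set where
  d₁ d₂ : Demand

data Supply : Set where
  s₁ s₂ : Supply

record NodeVec (A : Set) : Set where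
  constructor vec
  field
    #d₁ #d₂ #s₁ #s₂ : A

open NodeVec public

infixl 6 _⊕_ _⊖_

_⊕_ : NodeVec ℕ → NodeVec ℕ → NodeVec ℕ
vec a b c d ⊕ vec a′ b′ c′ d′ =
  vec (a ℕ.+ a′) (b ℕ.+ b′) (c ℕ.+ c′) (d ℕ.+ d′)

-- Truncated; only used on x ⊖ y with y below x in every coordinate.
_⊖_ : NodeVec ℕ → NodeVec ℕ → NodeVec ℕ
vec a b c d ⊖ vec a′ b′ c′ d′ = vec (a ∸ a′) (b ∸ b′) (c ∸ c′) (d ∸ d′)

Balanced : NodeVec ℕ → Set
Balanced x = #d₁ x ℕ.+ #d₂ x ≡ #s₁ x ℕ.+ #s₂ x

record Queue : Set where
  constructor queue
  field
    items    : NodeVec ℕ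
    balanced : Balanced items

open Queue public

-- All four pairs may arrive, including the non-edge (d₂ , s₁).
Arrival : Set
Arrival = Demand × Supply

e : Arrival → NodeVec ℕ
e (i , j) = unitᵈ i ⊕ unitˢ j
  where
  unitᵈ : Demand → NodeVec ℕ
  unitᵈ d₁ = vec 1 0 0 0
  unitᵈ d₂ = vec 0 1 0 0

  unitˢ : Supply → NodeVec ℕ
  unitˢ s₁ = vec 0 0 1 0
  unitˢ s₂ = vec 0 0 0 1

State : Set
State = Queue × Arrival

private
  +-interchange : ∀ a b c d →
    (a ℕ.+ b) ℕ.+ (c ℕ.+ d) ≡ (a ℕ.+ c) ℕ.+ (b ℕ.+ d)
  +-interchange a b c d = begin
    (a ℕ.+ b) ℕ.+ (c ℕ.+ d)  ≡⟨ ℕ.+-assoc a b (c ℕ.+ d) ⟩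
    a ℕ.+ (b ℕ.+ (c ℕ.+ d))  ≡⟨ cong (a ℕ.+_) (ℕ.+-assoc b c d) ⟨
    a ℕ.+ (b ℕ.+ c ℕ.+ d)    ≡⟨ cong (λ t → a ℕ.+ (t ℕ.+ d)) (ℕ.+-comm b c) ⟩
    a ℕ.+ (c ℕ.+ b ℕ.+ d)    ≡⟨ cong (a ℕ.+_) (ℕ.+-assoc c b d) ⟩
    a ℕ.+ (c ℕ.+ (b ℕ.+ d))  ≡⟨ ℕ.+-assoc a c (b ℕ.+ d) ⟨
    (a ℕ.+ c) ℕ.+ (b ℕ.+ d)  ∎
    where open ≡-Reasoning

  ∸-interchange : ∀ {a b m n} → m ℕ.≤ a → n ℕ.≤ b →
    (a ∸ m) ℕ.+ (b ∸ n) ≡ (a ℕ.+ b) ∸ (m ℕ.+ n)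
  ∸-interchange {a} {b} {m} {n} m≤a n≤b = begin
    (a ∸ m) ℕ.+ (b ∸ n)    ≡⟨ ℕ.+-∸-assoc (a ∸ m) n≤b ⟨
    (a ∸ m) ℕ.+ b ∸ n      ≡⟨ cong (_∸ n) (ℕ.+-∸-comm b m≤a) ⟨
    a ℕ.+ b ∸ m ∸ n        ≡⟨ ℕ.∸-+-assoc (a ℕ.+ b) m n ⟩
    (a ℕ.+ b) ∸ (m ℕ.+ n)  ∎
    where open ≡-Reasoning

⊕-balanced : ∀ x y → Balanced x → Balanced y → Balanced (x ⊕ y)
⊕-balanced (vec a b c d) (vec a′ b′ c′ d′) p q =
  trans (+-interchange a a′ b b′)
    (trans (cong₂ ℕ._+_ p q) (+-interchange c d c′ d′))

e-balanced : ∀ a → Balanced (e a)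
e-balanced (d₁ , s₁) = refl
e-balanced (d₁ , s₂) = refl
e-balanced (d₂ , s₁) = refl
e-balanced (d₂ , s₂) = refl

-- X = Q + A
arrive : State → Queue
arrive (q , a) =
  queue (items q ⊕ e a) (⊕-balanced (items q) (e a) (balanced q) (e-balanced a))

-- u = u₁₁ e(d₁,s₁) + u₁₂ e(d₁,s₂) + u₂₂ e(d₂,s₂); the coefficients are
-- determined by the vector, so matchings are represented by them.
record Matching : Set where
  constructor matching
  field
    u₁₁ u₁₂ u₂₂ : ℕ

open Matching public

matched : Matching → NodeVec ℕ
matched (matching a b c) = vec (a ℕ.+ b) c a (b ℕ.+ c)

record Admissible (x : Queue) (u : Matching) : Set where
  field
    ≤d₁ : u₁₁ u ℕ.+ u₁₂ u ℕ.≤ #d₁ (items x)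
    ≤d₂ : u₂₂ u ℕ.≤ #d₂ (items x)
    ≤s₁ : u₁₁ u ℕ.≤ #s₁ (items x)
    ≤s₂ : u₁₂ u ℕ.+ u₂₂ u ℕ.≤ #s₂ (items x)

open Admissible public

remove : (x : Queue) (u : Matching) → Admissible x u → Queue
remove x u adm = queue (items x ⊖ matched u) (begin
  (#d₁ (items x) ∸ (u₁₁ u ℕ.+ u₁₂ u)) ℕ.+ (#d₂ (items x) ∸ u₂₂ u)
    ≡⟨ ∸-interchange (≤d₁ adm) (≤d₂ adm) ⟩
  (#d₁ (items x) ℕ.+ #d₂ (items x)) ∸ ((u₁₁ u ℕ.+ u₁₂ u) ℕ.+ u₂₂ u)
    ≡⟨ cong₂ _∸_ (balanced x) (ℕ.+-assoc (u₁₁ u) (u₁₂ u) (u₂₂ u)) ⟩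
  (#s₁ (items x) ℕ.+ #s₂ (items x)) ∸ (u₁₁ u ℕ.+ (u₁₂ u ℕ.+ u₂₂ u))
    ≡⟨ ∸-interchange (≤s₁ adm) (≤s₂ adm) ⟨
  (#s₁ (items x) ∸ u₁₁ u) ℕ.+ (#s₂ (items x) ∸ (u₁₂ u ℕ.+ u₂₂ u)) ∎)
  where open ≡-Reasoning

DecisionRule : Set
DecisionRule = (x : Queue) → Σ Matching (Admissible x)

Policy : Set
Policy = ℕ → DecisionRule

stationary : DecisionRule → Policy
stationary δ _ = δ

step : DecisionRule → State → Arrival → State
step δ y a = let (u , adm) = δ (arrive y) in remove (arrive y) u adm , a

-- Y(n), given Y(0) and the arrivals A(1), …, A(n).
stateAt : ∀ {n} → Policy → State → Vec Arrival n → State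
stateAt π y []       = y
stateAt π y (a ∷ as) = stateAt (λ k → π (suc k)) (step (π 0) y a) as

-- With truncated subtraction, the excess over a finite threshold t is 0
-- exactly when x_{d₁} - x_{s₁} ≤ t.
excess : ℕ ⁺ → NodeVec ℕ → ℕ
excess [ t ] x = (#d₁ x ∸ #s₁ x) ∸ t
excess ⊤⁺    x = 0

IsThresholdRule : ℕ ⁺ → DecisionRule → Set
IsThresholdRule t δ = ∀ x → let v = items x in
  proj₁ (δ x) ≡ matching (#d₁ v ⊓ #s₁ v) (excess t v) (#d₂ v ⊓ #s₂ v)

ThresholdType : DecisionRule → Set
ThresholdType δ = ∃ λ t → IsThresholdRule t δ

module Discounted (ℝ : CompleteOrderedField) where

  open CompleteOrderedField ℝ public

  open MonoidMult +-monoid public using () renaming (_×_ to _×ᴿ_)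
  open MonoidSum +-monoid public using (sum)
  open SemiringExp semiring public using (_^_)

  linearCost : NodeVec Carrier → NodeVec ℕ → Carrier
  linearCost c x = (#d₁ x ×ᴿ #d₁ c) + (#d₂ x ×ᴿ #d₂ c)
                 + (#s₁ x ×ᴿ #s₁ c) + (#s₂ x ×ᴿ #s₂ c)

  stateCost : NodeVec Carrier → State → Carrier
  stateCost c y = linearCost c (items (arrive y))

  module Arrivals (α β : Carrier) where

    probᵈ : Demand → Carrier
    probᵈ d₁ = α
    probᵈ d₂ = 1# - α

    probˢ : Supply → Carrier
    probˢ s₁ = β
    probˢ s₂ = 1# - β

    prob : Arrival → Carrier
    prob (i , j) = probᵈ i * probˢ j

    -- Expectation of F(A(1), …, A(n)) for i.i.d. arrivals.
    𝔼 : ∀ n → (Vec Arrival n → Carrier) → Carrier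
    𝔼 0       F = F []
    𝔼 (suc n) F = term (d₁ , s₁) + term (d₁ , s₂)
                + term (d₂ , s₁) + term (d₂ , s₂)
      where
      term : Arrival → Carrier
      term a = prob a * 𝔼 n (λ as → F (a ∷ as))

    expectedCost : NodeVec Carrier → Policy → State → ℕ → Carrier
    expectedCost c π y n = 𝔼 n (λ as → stateCost c (stateAt π y as))

    partialCost : NodeVec Carrier → Carrier → Policy → State → ℕ → Carrier
    partialCost c θ π y N =
      sum {N} (λ n → (θ ^ toℕ n) * expectedCost c π y (toℕ n))

    IsDiscountedCost :
      NodeVec Carrier → Carrier → Policy → State → Carrier → Set
    IsDiscountedCost c θ π y v = IsLimit (partialCost c θ π y) v

    -- Costs are nonnegative, so partial costs are nondecreasing in N: a
    -- policy without a limit in ℝ would have cost +∞ and not affect the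
    -- infimum.
    IsOptimalCost : NodeVec Carrier → Carrier → State → Carrier → Set
    IsOptimalCost c θ y =
      IsInfimum (λ w → ∃ λ π → IsDiscountedCost c θ π y w)

-- The dynamics depends on a queue x only through its surplus
-- ℓ(x) = x_{d₁} - x_{s₁} ∈ ℤ: matching (1,1) or (2,2) does not change it, and
-- matching (1,2) lowers it by one.  Among the queues with a given surplus the
-- cheapest is the one where (1,1) and (2,2) are exhausted, so priority to these
-- edges is optimal and a value iteration over functions J on ℤ remains.  The
-- minimum over (1,2)-matchings replaces J on ℓ ≥ 0 by its running minimum, which
-- is nonincreasing and preserves convexity; hence all iterates, and their limit
-- J∞, are convex, and stopping at the first ascent of J∞ attains the running
-- minimum.  The iterates bound the cost of every policy from below, and J∞
-- bounds that of the threshold policy from above.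

{-# OPTIONS --safe #-}

module Submission where

open import Defs
open import Axiom.ExcludedMiddle using (ExcludedMiddle)
open import Data.Fin.Base using (Fin; toℕ)
open import Data.Integer.Base as ℤ using (ℤ; +_; -[1+_])
open import Data.Integer.Properties as ℤ using ()
open import Data.Nat.Base as ℕ using (ℕ; zero; suc)
open import Data.Nat.Properties as ℕ using ()
open import Data.Product using (∃; _×_; _,_; proj₁; proj₂)
open import Data.Sum.Base using (inj₁; inj₂; [_,_]′)
open import Level using (0ℓ)
open import Relation.Binary.Bundles using (TotalOrder)
open import Relation.Binary.PropositionalEquality as ≡ using (_≡_)
open import Relation.Binary.Structures using (IsTotalOrder)
open import Relation.Nullary using (¬_; yes; no; contradiction)
open import Relation.Nullary.Construct.Add.Supremum using (_⁺; [_]; ⊤⁺)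
open import Algebra.Bundles using (CommutativeMonoid)
import Algebra.Construct.NaturalChoice.Min as Min
import Algebra.Properties.CommutativeMonoid.Mult as CommutativeMonoidMult
import Algebra.Properties.CommutativeSemigroup as CommutativeSemigroupProperties
import Algebra.Properties.Ring as RingProperties
import Algebra.Properties.Semiring.Mult as SemiringMult
import Relation.Binary.Construct.NonStrictToStrict as ToStrict
import Relation.Binary.Reasoning.PartialOrder as PartialOrderReasoning
import Relation.Binary.Reasoning.Setoid as SetoidReasoning

-- Surplus of a queue, residual queues and threshold matchings

module Surplus where

  open import Data.Nat.Base using (_∸_; _⊓_)
  open ≡ using (refl; sym; trans; cong; cong₂; subst; module ≡-Reasoning)
  open CommutativeSemigroupProperties ℤ.+-commutativeSemigroup using (interchange)

  surplus : NodeVec ℕ → ℤ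
  surplus v = #d₁ v ℤ.⊖ #s₁ v

  -- What is left of a queue with surplus i once the edges (1,1) and (2,2) are
  -- exhausted.
  residual : ℤ → NodeVec ℕ
  residual (+ n)    = vec n 0 0 n
  residual -[1+ n ] = vec 0 (suc n) (suc n) 0

  residual-balanced : ∀ i → Balanced (residual i)
  residual-balanced (+ n)    = ℕ.+-identityʳ n
  residual-balanced -[1+ n ] = sym (ℕ.+-identityʳ (suc n))

  surplus-residual : ∀ i → surplus (residual i) ≡ i
  surplus-residual (+ n)    = refl
  surplus-residual -[1+ n ] = refl

  surplus-⊕ : ∀ v w → surplus (v ⊕ w) ≡ surplus v ℤ.+ surplus w
  surplus-⊕ (vec a _ c _) (vec a′ _ c′ _) = begin
    (a ℕ.+ a′) ℤ.⊖ (c ℕ.+ c′)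
      ≡⟨ ℤ.m-n≡m⊖n (a ℕ.+ a′) (c ℕ.+ c′) ⟨
    (+ a ℤ.+ + a′) ℤ.+ (ℤ.- (+ c ℤ.+ + c′))
      ≡⟨ cong (λ i → (+ a ℤ.+ + a′) ℤ.+ i) (ℤ.neg-distrib-+ (+ c) (+ c′)) ⟩
    (+ a ℤ.+ + a′) ℤ.+ (ℤ.- + c ℤ.+ ℤ.- + c′)
      ≡⟨ interchange (+ a) (+ a′) (ℤ.- + c) (ℤ.- + c′) ⟩
    (+ a ℤ.+ ℤ.- + c) ℤ.+ (+ a′ ℤ.+ ℤ.- + c′)
      ≡⟨ cong₂ ℤ._+_ (ℤ.m-n≡m⊖n a c) (ℤ.m-n≡m⊖n a′ c′) ⟩
    (a ℤ.⊖ c) ℤ.+ (a′ ℤ.⊖ c′) ∎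
    where open ≡-Reasoning

  -- The two bounds make the truncated subtractions at d₁ and s₁ exact, after which `u₁₁ u` cancels.
  surplus-⊖ : ∀ v u → u₁₁ u ℕ.+ u₁₂ u ℕ.≤ #d₁ v → u₁₁ u ℕ.≤ #s₁ v →
    surplus v ≡ + u₁₂ u ℤ.+ surplus (v ⊖ matched u)
  surplus-⊖ (vec a _ c _) (matching k l _) k+l≤a k≤c = begin
    a ℤ.⊖ c
      ≡⟨ cong₂ ℤ._⊖_ (ℕ.m+[n∸m]≡n k+l≤a) (ℕ.m+[n∸m]≡n k≤c) ⟨
    (k ℕ.+ l ℕ.+ a′) ℤ.⊖ (k ℕ.+ c′)
      ≡⟨ cong (ℤ._⊖ (k ℕ.+ c′)) (ℕ.+-assoc k l a′) ⟩
    (k ℕ.+ (l ℕ.+ a′)) ℤ.⊖ (k ℕ.+ c′)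
      ≡⟨ ℤ.+-cancelˡ-⊖ k (l ℕ.+ a′) c′ ⟩
    (l ℕ.+ a′) ℤ.⊖ c′
      ≡⟨ ℤ.distribʳ-⊖-+-pos l a′ c′ ⟨
    + l ℤ.+ (a′ ℤ.⊖ c′) ∎
    where
    open ≡-Reasoning
    a′ = a ∸ (k ℕ.+ l)
    c′ = c ∸ k

  -- Normal form of a balanced vector: `k` pairs (1,1) and `l` pairs (2,2) on top of a residual.
  -- Being an indexed type, it turns an arbitrary balanced vector into this form by pattern
  -- matching.
  data Split : NodeVec ℕ → Set where
    split : ∀ k l i → Split (vec k l k l ⊕ residual i)

  -- Split off as many pairs (1,1) and (2,2) as the smaller counts allow. By balance, what remains
  -- on the demand side equals what remains on the supply side.
  balanced⇒split : ∀ v → Balanced v → Split v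
  balanced⇒split (vec a b c d) a+b≡c+d with ℕ.≤-<-connex c a
  ... | inj₁ c≤a = subst Split eq (split c b (+ n))
    where
    n = a ∸ c
    c+n≡a = ℕ.m+[n∸m]≡n c≤a

    b+n≡d : b ℕ.+ n ≡ d
    b+n≡d = ℕ.+-cancelˡ-≡ c _ _ (begin
      c ℕ.+ (b ℕ.+ n)  ≡⟨ cong (c ℕ.+_) (ℕ.+-comm b n) ⟩
      c ℕ.+ (n ℕ.+ b)  ≡⟨ ℕ.+-assoc c n b ⟨
      c ℕ.+ n ℕ.+ b    ≡⟨ cong (ℕ._+ b) c+n≡a ⟩
      a ℕ.+ b          ≡⟨ a+b≡c+d ⟩
      c ℕ.+ d          ∎)
      where open ≡-Reasoning

    eq : vec c b c b ⊕ residual (+ n) ≡ vec a b c d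
    eq rewrite c+n≡a | b+n≡d | ℕ.+-identityʳ b | ℕ.+-identityʳ c = refl
  ... | inj₂ a<c = subst Split eq (split a d -[1+ n ])
    where
    -- One less than the deficit c - a, since `-[1+ n ]` stands for -(1 + n).
    n = c ∸ suc a

    a+n≡c : a ℕ.+ suc n ≡ c
    a+n≡c = trans (ℕ.+-suc a n) (ℕ.m+[n∸m]≡n a<c)

    d+n≡b : d ℕ.+ suc n ≡ b
    d+n≡b = ℕ.+-cancelˡ-≡ a _ _ (begin
      a ℕ.+ (d ℕ.+ suc n)  ≡⟨ cong (a ℕ.+_) (ℕ.+-comm d (suc n)) ⟩
      a ℕ.+ (suc n ℕ.+ d)  ≡⟨ ℕ.+-assoc a (suc n) d ⟨
      a ℕ.+ suc n ℕ.+ d    ≡⟨ cong (ℕ._+ d) a+n≡c ⟩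
      c ℕ.+ d              ≡⟨ a+b≡c+d ⟨
      a ℕ.+ b              ∎)
      where open ≡-Reasoning

    eq : vec a d a d ⊕ residual -[1+ n ] ≡ vec a b c d
    eq rewrite a+n≡c | d+n≡b | ℕ.+-identityʳ a | ℕ.+-identityʳ d = refl

  surplus-split : ∀ k l i → surplus (vec k l k l ⊕ residual i) ≡ i
  surplus-split k l i = begin
    surplus (vec k l k l ⊕ residual i)
      ≡⟨ surplus-⊕ (vec k l k l) (residual i) ⟩
    (k ℤ.⊖ k) ℤ.+ surplus (residual i)
      ≡⟨ cong₂ ℤ._+_ (ℤ.n⊖n≡0 k) (surplus-residual i) ⟩
    ℤ.0ℤ ℤ.+ i
      ≡⟨ ℤ.+-identityˡ i ⟩
    i ∎
    where open ≡-Reasoning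

  -- The surplus that remains once the threshold rule has acted, see `threshold-residual`.
  clamp : ℕ ⁺ → ℤ → ℤ
  clamp [ t ] (+ n)    = + (n ⊓ t)
  clamp [ _ ] -[1+ n ] = -[1+ n ]
  clamp ⊤⁺    i        = i

  thresholdMatching : ℕ ⁺ → NodeVec ℕ → Matching
  thresholdMatching t v =
    matching (#d₁ v ⊓ #s₁ v) (excess t v) (#d₂ v ⊓ #s₂ v)

  excess≤ : ∀ t v → excess t v ℕ.≤ #d₁ v ∸ #s₁ v
  excess≤ [ t ] v = ℕ.m∸n≤m (#d₁ v ∸ #s₁ v) t
  excess≤ ⊤⁺    v = ℕ.z≤n

  -- Admissible because `excess` is at most `#d₁ v ∸ #s₁ v`, which is what (1,1) leaves at d₁ and,
  -- by balance, also what (2,2) leaves at s₂.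
  thresholdRule : ℕ ⁺ → DecisionRule
  thresholdRule t x = thresholdMatching t v , record
    { ≤d₁ = begin
        #d₁ v ⊓ #s₁ v ℕ.+ excess t v
          ≤⟨ ℕ.+-monoʳ-≤ (#d₁ v ⊓ #s₁ v) (excess≤ t v) ⟩
        #d₁ v ⊓ #s₁ v ℕ.+ (#d₁ v ∸ #s₁ v)
          ≡⟨ cong (ℕ._+ (#d₁ v ∸ #s₁ v)) (ℕ.⊓-comm (#d₁ v) (#s₁ v)) ⟩
        #s₁ v ⊓ #d₁ v ℕ.+ (#d₁ v ∸ #s₁ v)
          ≡⟨ ℕ.m⊓n+n∸m≡n (#s₁ v) (#d₁ v) ⟩
        #d₁ v ∎
    ; ≤d₂ = ℕ.m⊓n≤m (#d₂ v) (#s₂ v)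
    ; ≤s₁ = ℕ.m⊓n≤n (#d₁ v) (#s₁ v)
    ; ≤s₂ = begin
        excess t v ℕ.+ #d₂ v ⊓ #s₂ v
          ≤⟨ ℕ.+-monoˡ-≤ (#d₂ v ⊓ #s₂ v) (excess≤ t v) ⟩
        (#d₁ v ∸ #s₁ v) ℕ.+ #d₂ v ⊓ #s₂ v
          ≡⟨ cong (ℕ._+ #d₂ v ⊓ #s₂ v) (∸-balanced (#s₁ v) (#d₂ v) (balanced x)) ⟩
        (#s₂ v ∸ #d₂ v) ℕ.+ #d₂ v ⊓ #s₂ v
          ≡⟨ ℕ.+-comm (#s₂ v ∸ #d₂ v) (#d₂ v ⊓ #s₂ v) ⟩
        #d₂ v ⊓ #s₂ v ℕ.+ (#s₂ v ∸ #d₂ v)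
          ≡⟨ ℕ.m⊓n+n∸m≡n (#d₂ v) (#s₂ v) ⟩
        #s₂ v ∎
    }
    where
    open ℕ.≤-Reasoning
    v = items x

    ∸-balanced : ∀ {a d} c b → a ℕ.+ b ≡ c ℕ.+ d → a ∸ c ≡ d ∸ b
    ∸-balanced {a} {d} c b a+b≡c+d = begin-equality
      a ∸ c                      ≡⟨ ℕ.[m+n]∸[m+o]≡n∸o b a c ⟨
      (b ℕ.+ a) ∸ (b ℕ.+ c)      ≡⟨ cong₂ _∸_ (ℕ.+-comm b a) (ℕ.+-comm b c) ⟩
      (a ℕ.+ b) ∸ (c ℕ.+ b)      ≡⟨ cong (_∸ (c ℕ.+ b)) a+b≡c+d ⟩
      (c ℕ.+ d) ∸ (c ℕ.+ b)      ≡⟨ ℕ.[m+n]∸[m+o]≡n∸o c d b ⟩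
      d ∸ b                      ∎

  -- Under the threshold rule every queue after matching is a residual, hence a cheapest queue for
  -- its surplus. The pairs of the split cancel, and for a surplus `n` and a finite `t` the rest is
  -- n - (n - t) = min(n, t) in truncated subtraction.
  threshold-residual : ∀ t {v} → Split v →
    v ⊖ matched (thresholdMatching t v) ≡ residual (clamp t (surplus v))
  threshold-residual t (split k l i) = trans (helper t i)
    (cong (λ j → residual (clamp t j)) (sym (surplus-split k l i)))
    where
    n∸[n∸t]≡n⊓t : ∀ n t → n ∸ (n ∸ t) ≡ n ⊓ t
    n∸[n∸t]≡n⊓t n t = begin
      n ∸ (n ∸ t)                    ≡⟨ cong (_∸ (n ∸ t)) (ℕ.m⊓n+n∸m≡n t n) ⟨
      t ⊓ n ℕ.+ (n ∸ t) ∸ (n ∸ t)    ≡⟨ ℕ.m+n∸n≡m (t ⊓ n) (n ∸ t) ⟩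
      t ⊓ n                          ≡⟨ ℕ.⊓-comm t n ⟩
      n ⊓ t                          ∎
      where open ≡-Reasoning

    afterSurplus : ∀ n m → let v = vec k l k l ⊕ residual (+ n) in
      v ⊖ matched (matching (#d₁ v ⊓ #s₁ v) m (#d₂ v ⊓ #s₂ v)) ≡
      residual (+ (n ∸ m))
    afterSurplus n m
      rewrite ℕ.+-identityʳ k | ℕ.+-identityʳ l
            | ℕ.m≥n⇒m⊓n≡n (ℕ.m≤m+n k n) | ℕ.m≤n⇒m⊓n≡m (ℕ.m≤m+n l n)
            | ℕ.[m+n]∸[m+o]≡n∸o k n m | ℕ.n∸n≡0 k | ℕ.n∸n≡0 l
            | ℕ.+-comm m l | ℕ.[m+n]∸[m+o]≡n∸o l n m
            = refl

    afterDeficit : ∀ n → let v = vec k l k l ⊕ residual -[1+ n ] in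
      v ⊖ matched (matching (#d₁ v ⊓ #s₁ v) 0 (#d₂ v ⊓ #s₂ v)) ≡
      residual -[1+ n ]
    afterDeficit n
      rewrite ℕ.+-identityʳ k | ℕ.+-identityʳ l
            | ℕ.m≤n⇒m⊓n≡m (ℕ.m≤m+n k (suc n))
            | ℕ.m≥n⇒m⊓n≡n (ℕ.m≤m+n l (suc n))
            | ℕ.+-identityʳ k | ℕ.m+n∸m≡n k (suc n) | ℕ.m+n∸m≡n l (suc n)
            | ℕ.n∸n≡0 k | ℕ.n∸n≡0 l
            = refl

    noSurplus : ∀ n → (k ℕ.+ 0) ∸ (k ℕ.+ suc n) ≡ 0
    noSurplus n = trans (ℕ.[m+n]∸[m+o]≡n∸o k 0 (suc n)) refl

    helper : ∀ t i → let v = vec k l k l ⊕ residual i in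
      v ⊖ matched (thresholdMatching t v) ≡ residual (clamp t i)
    helper [ t ] (+ n) = trans
      (afterSurplus n (excess [ t ] (vec k l k l ⊕ residual (+ n))))
      (cong (λ m → residual (+ m)) (begin
        n ∸ (k ℕ.+ n ∸ (k ℕ.+ 0) ∸ t)
          ≡⟨ cong (λ m → n ∸ (m ∸ t)) (ℕ.[m+n]∸[m+o]≡n∸o k n 0) ⟩
        n ∸ (n ∸ t)
          ≡⟨ n∸[n∸t]≡n⊓t n t ⟩
        n ⊓ t ∎))
      where open ≡-Reasoning
    helper ⊤⁺    (+ n) = afterSurplus n 0
    helper [ t ] -[1+ n ]
      rewrite noSurplus n | ℕ.0∸n≡0 t = afterDeficit n
    helper ⊤⁺    -[1+ n ] = afterDeficit n

open Surplus

-- Inequalities in an ordered field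

module OrderedField (em : ExcludedMiddle 0ℓ) (ℝ : CompleteOrderedField) where

  open CompleteOrderedField ℝ
  open IsTotalOrder isTotalOrder public
    using (total; antisym; ≤-respˡ-≈; ≤-respʳ-≈)
    renaming (refl to ≤-refl; trans to ≤-trans; reflexive to ≤-reflexive)

  totalOrder : TotalOrder 0ℓ 0ℓ 0ℓ
  totalOrder = record { isTotalOrder = isTotalOrder }

  open TotalOrder totalOrder public using (poset)
  open Min totalOrder public
    using (_⊓_; x⊓y≤x; x⊓y≤y; ⊓-glb; ⊓-mono-≤)
  open RingProperties ring public using (-‿distribˡ-*; -‿involutive)
  open CommutativeMonoid +-commutativeMonoid using (commutativeSemigroup)
  open CommutativeSemigroupProperties commutativeSemigroup public
    using (interchange)
  module ≤-Reasoning = PartialOrderReasoning poset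

  ≰⇒> : ∀ {x y} → ¬ (x ≤ y) → y < x
  ≰⇒> = ToStrict.≰⇒> _≈_ _≤_ sym ≤-reflexive total

  <⇒≱ : ∀ {x y} → x < y → ¬ (y ≤ x)
  <⇒≱ = ToStrict.<⇒≱ _≈_ _≤_ antisym

  +-mono-≤ : ∀ {x y u v} → x ≤ y → u ≤ v → x + u ≤ y + v
  +-mono-≤ {x} {y} {u} {v} x≤y u≤v = begin
    x + u  ≤⟨ +-monoˡ-≤ u x≤y ⟩
    y + u  ≈⟨ +-comm y u ⟩
    u + y  ≤⟨ +-monoˡ-≤ y u≤v ⟩
    v + y  ≈⟨ +-comm v y ⟩
    y + v  ∎
    where open ≤-Reasoning

  +-monoʳ-≤ : ∀ z {x y} → x ≤ y → z + x ≤ z + y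
  +-monoʳ-≤ z = +-mono-≤ ≤-refl

  x+z-z≈x : ∀ x z → x + z - z ≈ x
  x+z-z≈x x z = trans (+-assoc x z (- z))
    (trans (+-congˡ (-‿inverseʳ z)) (+-identityʳ x))

  x-z+z≈x : ∀ x z → x - z + z ≈ x
  x-z+z≈x x z = trans (+-assoc x (- z) z)
    (trans (+-congˡ (-‿inverseˡ z)) (+-identityʳ x))

  +-cancelʳ-≤ : ∀ z {x y} → x + z ≤ y + z → x ≤ y
  +-cancelʳ-≤ z {x} {y} x+z≤y+z = begin
    x          ≈⟨ x+z-z≈x x z ⟨
    x + z - z  ≤⟨ +-monoˡ-≤ (- z) x+z≤y+z ⟩
    y + z - z  ≈⟨ x+z-z≈x y z ⟩
    y          ∎
    where open ≤-Reasoning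

  +-cancelˡ-≤ : ∀ z {x y} → z + x ≤ z + y → x ≤ y
  +-cancelˡ-≤ z {x} {y} z+x≤z+y = +-cancelʳ-≤ z (begin
    x + z  ≈⟨ +-comm x z ⟩
    z + x  ≤⟨ z+x≤z+y ⟩
    z + y  ≈⟨ +-comm z y ⟩
    y + z  ∎)
    where open ≤-Reasoning

  x+z≤y⇒x≤y-z : ∀ {x y z} → x + z ≤ y → x ≤ y - z
  x+z≤y⇒x≤y-z {x} {y} {z} x+z≤y =
    +-cancelʳ-≤ z (≤-respʳ-≈ (sym (x-z+z≈x y z)) x+z≤y)

  x≤y-z⇒x+z≤y : ∀ {x y z} → x ≤ y - z → x + z ≤ y
  x≤y-z⇒x+z≤y {x} {y} {z} x≤y-z =
    ≤-respʳ-≈ (x-z+z≈x y z) (+-monoˡ-≤ z x≤y-z)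

  x≤y⇒0≤y-x : ∀ {x y} → x ≤ y → 0# ≤ y - x
  x≤y⇒0≤y-x {x} {y} x≤y = x+z≤y⇒x≤y-z (≤-respˡ-≈ (sym (+-identityˡ x)) x≤y)

  +-nonneg : ∀ {x y} → 0# ≤ x → 0# ≤ y → 0# ≤ x + y
  +-nonneg 0≤x 0≤y = ≤-respˡ-≈ (+-identityˡ 0#) (+-mono-≤ 0≤x 0≤y)

  x≤x+y : ∀ {x y} → 0# ≤ y → x ≤ x + y
  x≤x+y {x} 0≤y = ≤-respˡ-≈ (+-identityʳ x) (+-monoʳ-≤ x 0≤y)

  x≤y+x : ∀ {x y} → 0# ≤ y → x ≤ y + x
  x≤y+x {x} 0≤y = ≤-respˡ-≈ (+-identityˡ x) (+-monoˡ-≤ x 0≤y)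

  *-monoˡ-≤-nonneg : ∀ {z x y} → 0# ≤ z → x ≤ y → z * x ≤ z * y
  *-monoˡ-≤-nonneg {z} {x} {y} 0≤z x≤y = begin
    z * x                ≤⟨ x≤y+x (*-nonneg 0≤z (x≤y⇒0≤y-x x≤y)) ⟩
    z * (y - x) + z * x  ≈⟨ distribˡ z (y - x) x ⟨
    z * (y - x + x)      ≈⟨ *-congˡ (x-z+z≈x y x) ⟩
    z * y                ∎
    where open ≤-Reasoning

  0≤1 : 0# ≤ 1#
  0≤1 with total 0# 1#
  ... | inj₁ 0≤1 = 0≤1
  ... | inj₂ 1≤0 = begin
    0#             ≤⟨ *-nonneg 0≤-1 0≤-1 ⟩
    - 1# * - 1#    ≈⟨ -‿distribˡ-* 1# (- 1#) ⟨
    - (1# * - 1#)  ≈⟨ -‿cong (*-identityˡ (- 1#)) ⟩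
    - - 1#         ≈⟨ -‿involutive 1# ⟩
    1#             ∎
    where
    open ≤-Reasoning
    0≤-1 : 0# ≤ - 1#
    0≤-1 = ≤-respʳ-≈ (+-identityˡ (- 1#)) (x≤y⇒0≤y-x 1≤0)

  inverse-nonneg : ∀ {x y} → 0# ≤ x → x * y ≈ 1# → 0# ≤ y
  inverse-nonneg {x} {y} 0≤x xy≈1 with total 0# y
  ... | inj₁ 0≤y = 0≤y
  ... | inj₂ y≤0 = contradiction (antisym 0≤1 1≤0) 0≉1
    where
    open ≤-Reasoning
    1≤0 : 1# ≤ 0#
    1≤0 = begin
      1#      ≈⟨ xy≈1 ⟨
      x * y   ≤⟨ *-monoˡ-≤-nonneg 0≤x y≤0 ⟩
      x * 0#  ≈⟨ zeroʳ x ⟩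
      0#      ∎

  -- Limits of nondecreasing sequences

  infix 4 _↗_

  -- Convergence expressed by order alone: the limit of a nondecreasing sequence is its least upper
  -- bound. Without any ε, passing to a limit becomes a comparison of bounds.
  record _↗_ (f : ℕ → Carrier) (l : Carrier) : Set where
    field
      monotone : ∀ {m n} → m ℕ.≤ n → f m ≤ f n
      upper    : ∀ n → f n ≤ l
      least    : ∀ b → (∀ n → f n ≤ b) → l ≤ b

  open _↗_ public

  -- Completeness enters here, applied to the range of the sequence.
  ↗-sup : ∀ {f b} → (∀ n → f n ≤ f (suc n)) → (∀ n → f n ≤ b) → ∃ (f ↗_)
  ↗-sup {f} {b} f≤f∘suc f≤b =
    let s , f≤s , s-least = complete (λ x → ∃ λ n → x ≡ f n)
          (f 0 , 0 , ≡.refl) (b , λ { _ (n , ≡.refl) → f≤b n })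
    in s , record
      { monotone = λ m≤n → mono (ℕ.≤⇒≤′ m≤n)
      ; upper    = λ n → f≤s (f n) (n , ≡.refl)
      ; least    = λ b f≤b → s-least b λ { _ (n , ≡.refl) → f≤b n }
      }
    where
    mono : ∀ {m n} → m ℕ.≤′ n → f m ≤ f n
    mono ℕ.≤′-refl       = ≤-refl
    mono (ℕ.≤′-step m≤n) = ≤-trans (mono m≤n) (f≤f∘suc _)

  ↗-const : ∀ x → (λ _ → x) ↗ x
  ↗-const x = record
    { monotone = λ _ → ≤-refl
    ; upper    = λ _ → ≤-refl
    ; least    = λ b x≤b → x≤b 0
    }

  -- A bound on f n + g n also bounds f i + g j for independent indices, by monotonicity up to the
  -- larger one. The supremum can then be taken over `i` and over `j` separately.
  ↗-+ : ∀ {f g l m} → f ↗ l → g ↗ m → (λ n → f n + g n) ↗ l + m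
  ↗-+ {f} {g} {l} {m} f↗l g↗m = record
    { monotone = λ i≤j → +-mono-≤ (monotone f↗l i≤j) (monotone g↗m i≤j)
    ; upper    = λ n → +-mono-≤ (upper f↗l n) (upper g↗m n)
    ; least    = λ b f+g≤b →
        ≤-respˡ-≈ (+-comm m l) (x≤y-z⇒x+z≤y (least g↗m _ λ j →
        x+z≤y⇒x≤y-z (≤-respˡ-≈ (+-comm l (g j))
        (x≤y-z⇒x+z≤y (least f↗l _ λ i → x+z≤y⇒x≤y-z (begin
          f i + g j
            ≤⟨ +-mono-≤ (monotone f↗l (ℕ.m≤m⊔n i j))
                        (monotone g↗m (ℕ.m≤n⊔m i j)) ⟩
          f (i ℕ.⊔ j) + g (i ℕ.⊔ j)
            ≤⟨ f+g≤b (i ℕ.⊔ j) ⟩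
          b ∎))))))
    }
    where open ≤-Reasoning

  -- Unless z is 0 and all multiples vanish, dividing by z turns a bound on the multiples into one
  -- on the sequence.
  ↗-* : ∀ {f l z} → 0# ≤ z → f ↗ l → (λ n → z * f n) ↗ z * l
  ↗-* {f} {l} {z} 0≤z f↗l = record
    { monotone = λ m≤n → *-monoˡ-≤-nonneg 0≤z (monotone f↗l m≤n)
    ; upper    = λ n → *-monoˡ-≤-nonneg 0≤z (upper f↗l n)
    ; least    = least-*
    }
    where
    open ≤-Reasoning

    least-* : ∀ b → (∀ n → z * f n ≤ b) → z * l ≤ b
    least-* b zf≤b with em {z ≈ 0#}
    ... | yes z≈0 = begin
      z * l    ≈⟨ *-congʳ z≈0 ⟩
      0# * l   ≈⟨ zeroˡ l ⟩
      0#       ≈⟨ zeroˡ (f 0) ⟨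
      0# * f 0 ≈⟨ *-congʳ z≈0 ⟨
      z * f 0  ≤⟨ zf≤b 0 ⟩
      b        ∎
    ... | no z≉0 = begin
      z * l        ≤⟨ *-monoˡ-≤-nonneg 0≤z (least f↗l (w * b) f≤wb) ⟩
      z * (w * b)  ≈⟨ *-assoc z w b ⟨
      z * w * b    ≈⟨ *-congʳ zw≈1 ⟩
      1# * b       ≈⟨ *-identityˡ b ⟩
      b            ∎
      where
      w = proj₁ (inverse z z≉0)
      zw≈1 = proj₂ (inverse z z≉0)

      f≤wb : ∀ n → f n ≤ w * b
      f≤wb n = begin
        f n            ≈⟨ *-identityˡ (f n) ⟨
        1# * f n       ≈⟨ *-congʳ zw≈1 ⟨
        z * w * f n    ≈⟨ *-congʳ (*-comm z w) ⟩
        w * z * f n    ≈⟨ *-assoc w z (f n) ⟩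
        w * (z * f n)  ≤⟨ *-monoˡ-≤-nonneg (inverse-nonneg 0≤z zw≈1) (zf≤b n) ⟩
        w * b          ∎

  -- If `b` bounds f, it bounds `l`. Otherwise `b` bounds g: once g exceeded `b` it would stay above
  -- it, so from there on the minimum below `b` would have to be f, and `b` would bound f after all.
  ↗-⊓ : ∀ {f g l m} → f ↗ l → g ↗ m → (λ n → f n ⊓ g n) ↗ l ⊓ m
  ↗-⊓ {f} {g} {l} {m} f↗l g↗m = record
    { monotone = λ i≤j → ⊓-mono-≤ (monotone f↗l i≤j) (monotone g↗m i≤j)
    ; upper    = λ n → ⊓-mono-≤ (upper f↗l n) (upper g↗m n)
    ; least    = least-⊓
    }
    where
    least-⊓ : ∀ b → (∀ n → f n ⊓ g n ≤ b) → l ⊓ m ≤ b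
    least-⊓ b f⊓g≤b with em {∀ n → f n ≤ b}
    ... | yes f≤b = ≤-trans (x⊓y≤x l m) (least f↗l b f≤b)
    ... | no f≰b = ≤-trans (x⊓y≤y l m) (least g↗m b g≤b)
      where
      g≤b : ∀ j → g j ≤ b
      g≤b j with em {g j ≤ b}
      ... | yes gj≤b = gj≤b
      ... | no gj≰b = contradiction f≤b f≰b
        where
        b≤g : ∀ i → b ≤ g (i ℕ.⊔ j)
        b≤g i = ≤-trans (proj₁ (≰⇒> gj≰b)) (monotone g↗m (ℕ.m≤n⊔m i j))

        f≤b : ∀ i → f i ≤ b
        f≤b i with em {f i ≤ b}
        ... | yes fi≤b = fi≤b
        ... | no fi≰b with total (f (i ℕ.⊔ j)) (g (i ℕ.⊔ j))
        ...   | inj₁ f≤g = ≤-trans (monotone f↗l (ℕ.m≤m⊔n i j))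
          (≤-trans (⊓-glb ≤-refl f≤g) (f⊓g≤b (i ℕ.⊔ j)))
        ...   | inj₂ g≤f = contradiction
          (≤-trans (monotone g↗m (ℕ.m≤n⊔m i j))
            (≤-trans (⊓-glb g≤f ≤-refl) (f⊓g≤b (i ℕ.⊔ j)))) gj≰b

  x<x+z : ∀ {x z} → 0# < z → x < x + z
  x<x+z {x} {z} 0<z = ≰⇒> λ x+z≤x → <⇒≱ 0<z
    (+-cancelˡ-≤ x (≤-respʳ-≈ (sym (+-identityʳ x)) x+z≤x))

  x-z<x : ∀ {x z} → 0# < z → x - z < x
  x-z<x {x} {z} 0<z = ≰⇒> λ x≤x-z → <⇒≱ (x<x+z 0<z) (x≤y-z⇒x+z≤y x≤x-z)

  ↗-exceeds : ∀ {f l b} → f ↗ l → b < l → ∃ λ n → b < f n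
  ↗-exceeds {f} {l} {b} f↗l b<l with em {∃ λ n → b < f n}
  ... | yes exceeds = exceeds
  ... | no ¬exceeds = contradiction (least f↗l b f≤b) (<⇒≱ b<l)
    where
    f≤b : ∀ n → f n ≤ b
    f≤b n with em {f n ≤ b}
    ... | yes fn≤b = fn≤b
    ... | no fn≰b = contradiction (n , ≰⇒> fn≰b) ¬exceeds

  -- Once f exceeds l - ε, g is trapped between f and `l`. In the application f is the value
  -- iteration and g the partial cost, which is one stage ahead.
  squeeze-limit : ∀ {f g l} → f ↗ l → (∀ n → f n ≤ g (suc n)) →
    (∀ n → g n ≤ l) → IsLimit g l
  squeeze-limit {f} {g} {l} f↗l f≤g g≤l ε 0<ε =
    -- Starting at `suc n` excludes index 0, at which f gives no bound on g.
    suc n , λ where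
      (suc m) (ℕ.s≤s n≤m) →
        (begin-strict
          l - ε      <⟨ l-ε<fn ⟩
          f n        ≤⟨ monotone f↗l n≤m ⟩
          f m        ≤⟨ f≤g m ⟩
          g (suc m)  ∎) ,
        (begin-strict
          g (suc m)  ≤⟨ g≤l (suc m) ⟩
          l          <⟨ x<x+z 0<ε ⟩
          l + ε      ∎)
    where
    open ≤-Reasoning
    n = proj₁ (↗-exceeds f↗l (x-z<x 0<ε))
    l-ε<fn = proj₂ (↗-exceeds f↗l (x-z<x 0<ε))

  -- If some f n exceeded `w`, then with ε = f n - w the sequence g would eventually lie below w + ε
  -- = f n, whereas it eventually lies above f n.
  limit-dominates : ∀ {f g l w} → f ↗ l → (∀ n → f n ≤ g (suc n)) →
    IsLimit g w → l ≤ w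
  limit-dominates {f} {g} {l} {w} f↗l f≤g g→w = least f↗l w f≤w
    where
    f≤w : ∀ n → f n ≤ w
    f≤w n with em {f n ≤ w}
    ... | yes fn≤w = fn≤w
    ... | no fn≰w = contradiction fn≤g (<⇒≱ g<fn)
      where
      open ≤-Reasoning
      ε = f n - w

      0<ε : 0# < ε
      0<ε = ≰⇒> λ ε≤0 → fn≰w (begin
        f n            ≈⟨ x-z+z≈x (f n) w ⟨
        f n - w + w    ≤⟨ +-monoˡ-≤ w ε≤0 ⟩
        0# + w         ≈⟨ +-identityˡ w ⟩
        w              ∎)

      n₀ = proj₁ (g→w ε 0<ε)
      m = suc (n ℕ.⊔ n₀)

      fn≤g : f n ≤ g m
      fn≤g = ≤-trans (monotone f↗l (ℕ.m≤m⊔n n n₀)) (f≤g (n ℕ.⊔ n₀))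

      g<fn : g m < f n
      g<fn = begin-strict
        g m          <⟨ proj₂ (proj₂ (g→w ε 0<ε) m (ℕ.m≤n⇒m≤1+n (ℕ.m≤n⊔m n n₀))) ⟩
        w + ε        ≈⟨ +-comm w ε ⟩
        f n - w + w  ≈⟨ x-z+z≈x (f n) w ⟩
        f n          ∎

  -- The witness is x / (1 - θ), the sum of the geometric series with first term `x`, characterised
  -- by its fixed-point equation.
  geometric : ∀ {θ} → 0# ≤ θ → θ < 1# → ∀ {x} → 0# ≤ x →
    ∃ λ y → 0# ≤ y × x + θ * y ≈ y
  geometric {θ} 0≤θ (θ≤1 , θ≉1) {x} 0≤x =
    w * x , *-nonneg (inverse-nonneg (x≤y⇒0≤y-x θ≤1) [1-θ]w≈1) 0≤x , (begin
      x + θ * (w * x)                        ≈⟨ +-congʳ x≈[1-θ]wx ⟩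
      (1# - θ) * (w * x) + θ * (w * x)       ≈⟨ distribʳ (w * x) (1# - θ) θ ⟨
      (1# - θ + θ) * (w * x)                 ≈⟨ *-congʳ (x-z+z≈x 1# θ) ⟩
      1# * (w * x)                           ≈⟨ *-identityˡ (w * x) ⟩
      w * x                                  ∎)
    where
    1-θ≉0 : ¬ (1# - θ ≈ 0#)
    1-θ≉0 1-θ≈0 = θ≉1 (trans (sym (+-identityˡ θ))
      (trans (+-congʳ (sym 1-θ≈0)) (x-z+z≈x 1# θ)))
    w = proj₁ (inverse (1# - θ) 1-θ≉0)
    [1-θ]w≈1 = proj₂ (inverse (1# - θ) 1-θ≉0)

    x≈[1-θ]wx : x ≈ (1# - θ) * (w * x)
    x≈[1-θ]wx = trans (sym (*-identityˡ x))
      (trans (*-congʳ (sym [1-θ]w≈1)) (*-assoc (1# - θ) w x))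

    open SetoidReasoning setoid

  -- Convex functions on the integers

  Convex : (ℤ → Carrier) → Set
  Convex f = ∀ i → f (ℤ.suc i) + f (ℤ.suc i) ≤ f i + f (ℤ.suc (ℤ.suc i))

  Nonincreasing : (ℤ → Carrier) → Set
  Nonincreasing f = ∀ i → f (ℤ.suc i) ≤ f i

  convex-+ : ∀ {f g} → Convex f → Convex g → Convex (λ i → f i + g i)
  convex-+ {f} {g} f-convex g-convex i = begin
    (f j + g j) + (f j + g j)  ≈⟨ interchange (f j) (g j) (f j) (g j) ⟩
    (f j + f j) + (g j + g j)  ≤⟨ +-mono-≤ (f-convex i) (g-convex i) ⟩
    (f i + f k) + (g i + g k)  ≈⟨ interchange (f i) (f k) (g i) (g k) ⟩
    (f i + g i) + (f k + g k)  ∎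
    where
    open ≤-Reasoning
    j = ℤ.suc i
    k = ℤ.suc j

  convex-* : ∀ {z f} → 0# ≤ z → Convex f → Convex (λ i → z * f i)
  convex-* {z} {f} 0≤z f-convex i = begin
    z * f j + z * f j  ≈⟨ distribˡ z (f j) (f j) ⟨
    z * (f j + f j)    ≤⟨ *-monoˡ-≤-nonneg 0≤z (f-convex i) ⟩
    z * (f i + f k)    ≈⟨ distribˡ z (f i) (f k) ⟩
    z * f i + z * f k  ∎
    where
    open ≤-Reasoning
    j = ℤ.suc i
    k = ℤ.suc j

  convex-const : ∀ x → Convex (λ _ → x)
  convex-const x i = ≤-refl

  convex-shift : ∀ s {f} → Convex f → Convex (λ i → f (i ℤ.+ s))
  convex-shift s f-convex i
    rewrite ℤ.+-assoc ℤ.1ℤ (ℤ.1ℤ ℤ.+ i) s | ℤ.+-assoc ℤ.1ℤ i s =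
    f-convex (i ℤ.+ s)

  convex-↗ : {f : ℕ → ℤ → Carrier} {F : ℤ → Carrier} →
    (∀ n → Convex (f n)) → (∀ i → (λ n → f n i) ↗ F i) → Convex F
  convex-↗ {f} {F} f-convex f↗F i =
    least (↗-+ (f↗F j) (f↗F j)) _ λ n →
      ≤-trans (f-convex n i) (+-mono-≤ (upper (f↗F i) n) (upper (f↗F k) n))
    where
    j = ℤ.suc i
    k = ℤ.suc j

  nonincreasing-+ : ∀ {f} → Nonincreasing f → ∀ n i → f (+ n ℤ.+ i) ≤ f i
  nonincreasing-+ {f} f-noninc zero    i =
    ≤-reflexive (reflexive (≡.cong f (ℤ.+-identityˡ i)))
  nonincreasing-+ {f} f-noninc (suc n) i = begin
    f (+ suc n ℤ.+ i)          ≡⟨ ≡.cong f (ℤ.+-assoc ℤ.1ℤ (+ n) i) ⟩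
    f (ℤ.suc (+ n ℤ.+ i))      ≤⟨ f-noninc (+ n ℤ.+ i) ⟩
    f (+ n ℤ.+ i)              ≤⟨ nonincreasing-+ f-noninc n i ⟩
    f i                        ∎
    where open ≤-Reasoning

  -- Running minima from 0 onward, and the points that attain them

  flatten : (ℤ → Carrier) → ℤ → Carrier
  flatten f (+ zero)    = f (+ 0)
  flatten f (+ (suc n)) = flatten f (+ n) ⊓ f (+ suc n)
  flatten f -[1+ n ]    = f -[1+ n ]

  flatten≤ : ∀ f i → flatten f i ≤ f i
  flatten≤ f (+ zero)    = ≤-refl
  flatten≤ f (+ (suc n)) = x⊓y≤y (flatten f (+ n)) (f (+ suc n))
  flatten≤ f -[1+ n ]    = ≤-refl

  flatten-mono : ∀ {f g} → (∀ i → f i ≤ g i) → ∀ i → flatten f i ≤ flatten g i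
  flatten-mono f≤g (+ zero)    = f≤g (+ 0)
  flatten-mono f≤g (+ (suc n)) = ⊓-mono-≤ (flatten-mono f≤g (+ n)) (f≤g (+ suc n))
  flatten-mono f≤g -[1+ n ]    = f≤g -[1+ n ]

  flatten-const : ∀ x i → x ≤ flatten (λ _ → x) i
  flatten-const x (+ zero)    = ≤-refl
  flatten-const x (+ (suc n)) = ⊓-glb (flatten-const x (+ n)) ≤-refl
  flatten-const x -[1+ n ]    = ≤-refl

  flatten-↗ : {f : ℕ → ℤ → Carrier} {F : ℤ → Carrier} →
    (∀ i → (λ n → f n i) ↗ F i) →
    ∀ i → (λ n → flatten (f n) i) ↗ flatten F i
  flatten-↗         f↗F (+ zero)    = f↗F (+ 0)
  flatten-↗ {f} {F} f↗F (+ (suc n)) =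
    ↗-⊓ (flatten-↗ {f} {F} f↗F (+ n)) (f↗F (+ suc n))
  flatten-↗ f↗F -[1+ n ]    = f↗F -[1+ n ]

  -- Slopes of a convex function are nondecreasing, so a descent propagates to the left;
  -- `convex-ascent` is the mirror image.
  convex-descent : ∀ {f} → Convex f → ∀ i →
    f (ℤ.suc (ℤ.suc i)) ≤ f (ℤ.suc i) → f (ℤ.suc i) ≤ f i
  convex-descent f-convex i fk≤fj =
    +-cancelʳ-≤ _ (≤-trans (f-convex i) (+-monoʳ-≤ _ fk≤fj))

  convex-ascent : ∀ {f} → Convex f → ∀ i →
    f i ≤ f (ℤ.suc i) → f (ℤ.suc i) ≤ f (ℤ.suc (ℤ.suc i))
  convex-ascent f-convex i fi≤fj =
    +-cancelˡ-≤ _ (≤-trans (f-convex i) (+-monoˡ-≤ _ fi≤fj))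

  -- A descent from -1 to 0 extends by convexity to all negative integers. The running minimum,
  -- which starts only at 0, is then nonincreasing across 0 as well.
  module Flatten {f : ℤ → Carrier} (f-convex : Convex f)
                 (f0≤f-1 : f (+ 0) ≤ f -[1+ 0 ]) where

    flatten-nonincreasing : Nonincreasing (flatten f)
    flatten-nonincreasing (+ n)          = x⊓y≤x (flatten f (+ n)) (f (+ suc n))
    flatten-nonincreasing -[1+ zero ]    = f0≤f-1
    flatten-nonincreasing -[1+ (suc n) ] =
      convex-descent f-convex -[1+ suc n ] (negative-nonincreasing n)
      where
      negative-nonincreasing : ∀ n → f (ℤ.suc -[1+ n ]) ≤ f -[1+ n ]
      negative-nonincreasing zero    = f0≤f-1
      negative-nonincreasing (suc n) =
        convex-descent f-convex -[1+ suc n ] (negative-nonincreasing n)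

    -- A descent right after `n` forces descents all the way from 0, so the minimum over 0 to `n` is
    -- attained at `n`.
    descending⇒≤flatten : ∀ n → f (+ suc n) ≤ f (+ n) → f (+ n) ≤ flatten f (+ n)
    descending⇒≤flatten zero    _     = ≤-refl
    descending⇒≤flatten (suc n) fk≤fj =
      ⊓-glb (≤-trans fj≤fi (descending⇒≤flatten n fj≤fi)) ≤-refl
      where fj≤fi = convex-descent f-convex (+ n) fk≤fj

    -- If f ascends after the middle point, the running minimum is constant from there on and
    -- monotonicity suffices. If f descends there, it has descended from 0, the running minimum
    -- coincides with f at all three points, and convexity of f applies.
    flatten-convex : Convex (flatten f)
    flatten-convex (+ n) with total (f (+ suc n)) (f (+ suc (suc n)))
    ... | inj₁ fj≤fk = +-mono-≤ (flatten-nonincreasing (+ n))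
      (⊓-glb ≤-refl (≤-trans (flatten≤ f (+ suc n)) fj≤fk))
    ... | inj₂ fk≤fj = begin
      flatten f (+ suc n) + flatten f (+ suc n)
        ≤⟨ +-mono-≤ (flatten≤ f (+ suc n)) (flatten≤ f (+ suc n)) ⟩
      f (+ suc n) + f (+ suc n)
        ≤⟨ f-convex (+ n) ⟩
      f (+ n) + f (+ suc (suc n))
        ≤⟨ +-mono-≤ (descending⇒≤flatten n (convex-descent f-convex (+ n) fk≤fj))
             (⊓-glb (≤-trans fk≤fj (descending⇒≤flatten (suc n) fk≤fj)) ≤-refl) ⟩
      flatten f (+ n) + flatten f (+ suc (suc n)) ∎
      where open ≤-Reasoning
    flatten-convex -[1+ zero ] =
      [ (λ f0≤f1 → +-mono-≤ f0≤f-1 (⊓-glb ≤-refl f0≤f1))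
      , (λ f1≤f0 → ≤-trans (f-convex -[1+ 0 ])
          (+-monoʳ-≤ (f -[1+ 0 ]) (⊓-glb f1≤f0 ≤-refl)))
      ]′ (total (f (+ 0)) (f (+ 1)))
    flatten-convex -[1+ (suc zero) ]    = f-convex -[1+ 1 ]
    flatten-convex -[1+ (suc (suc n)) ] = f-convex -[1+ suc (suc n) ]

    -- If f attains its running minimum at n + 1, then f (n + 1) is at most f n, and this descent
    -- makes f attain it at n too.
    ≤flatten-downward : ∀ {m n} → m ℕ.≤′ n →
      f (+ n) ≤ flatten f (+ n) → f (+ m) ≤ flatten f (+ m)
    ≤flatten-downward ℕ.≤′-refl             fn≤ = fn≤
    ≤flatten-downward (ℕ.≤′-step {n} m≤n) fn≤ =
      ≤flatten-downward m≤n (descending⇒≤flatten n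
        (≤-trans fn≤ (≤-trans (x⊓y≤x _ _) (flatten≤ f (+ n)))))

    -- Walk down from a known ascent while the preceding step also ascends. The walk ends at 0 or
    -- just after a descent; in both cases the running minimum is attained there.
    firstAscent : ∀ n → f (+ n) ≤ f (+ suc n) →
      ∃ λ t → f (+ t) ≤ f (+ suc t) × f (+ t) ≤ flatten f (+ t)
    firstAscent zero    f0≤f1 = 0 , f0≤f1 , ≤-refl
    firstAscent (suc n) fj≤fk with total (f (+ n)) (f (+ suc n))
    ... | inj₁ fi≤fj = firstAscent n fi≤fj
    ... | inj₂ fj≤fi = suc n , fj≤fk ,
      ⊓-glb (≤-trans fj≤fi (descending⇒≤flatten n fj≤fi)) ≤-refl

    -- If f never ascends on the naturals, every point attains its running minimum and the threshold
    -- is infinite. Otherwise the threshold is the first ascent: up to it f attains the running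
    -- minimum, and beyond it f stays above its value there.
    optimalThreshold : ∃ λ t → ∀ i → f (clamp t i) ≤ flatten f i
    optimalThreshold with em {∃ λ n → f (+ n) ≤ f (+ suc n)}
    ... | no ¬ascent = ⊤⁺ , λ where
      (+ n)    → descending⇒≤flatten n (proj₁ (≰⇒> λ fn≤ → ¬ascent (n , fn≤)))
      -[1+ n ] → ≤-refl
    ... | yes (n , fn≤) with firstAscent n fn≤
    ...   | t , ft≤ , ft≤flatten = [ t ] , optimal
      where
      ascending : ∀ {m} → t ℕ.≤′ m → f (+ m) ≤ f (+ suc m)
      ascending ℕ.≤′-refl       = ft≤
      ascending (ℕ.≤′-step t≤m) = convex-ascent f-convex _ (ascending t≤m)

      ft≤f : ∀ {m} → t ℕ.≤′ m → f (+ t) ≤ f (+ m)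
      ft≤f ℕ.≤′-refl       = ≤-refl
      ft≤f (ℕ.≤′-step t≤m) = ≤-trans (ft≤f t≤m) (ascending t≤m)

      beyond : ∀ {m} → t ℕ.≤′ m → f (+ t) ≤ flatten f (+ m)
      beyond ℕ.≤′-refl       = ft≤flatten
      beyond (ℕ.≤′-step t≤m) = ⊓-glb (beyond t≤m) (ft≤f (ℕ.≤′-step t≤m))

      optimal : ∀ i → f (clamp [ t ] i) ≤ flatten f i
      optimal -[1+ n ] = ≤-refl
      optimal (+ n) with ℕ.≤-total n t
      ... | inj₁ n≤t rewrite ℕ.m≤n⇒m⊓n≡m n≤t =
        ≤flatten-downward (ℕ.≤⇒≤′ n≤t) ft≤flatten
      ... | inj₂ t≤n rewrite ℕ.m≥n⇒m⊓n≡n t≤n = beyond (ℕ.≤⇒≤′ t≤n)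

module DiscountedMatching (em : ExcludedMiddle 0ℓ) (ℝ : CompleteOrderedField) where

  open Discounted ℝ
  open OrderedField em ℝ
  open ≤-Reasoning
  open SemiringMult semiring using (×-homo-+; ×-comm-*; ×-congʳ)
  open CommutativeMonoidMult +-commutativeMonoid using (×-distrib-+)

  module Model (α β : Carrier)
    (0≤α : 0# ≤ α) (α≤1 : α ≤ 1#) (0≤β : 0# ≤ β) (β≤1 : β ≤ 1#)
    (c : NodeVec Carrier)
    (cost-nonneg : ∀ (q : Queue) → 0# ≤ linearCost c (items q))
    (θ : Carrier) (0≤θ : 0# ≤ θ) (θ<1 : θ < 1#) where

    open Arrivals α β

    cost : NodeVec ℕ → Carrier
    cost = linearCost c

    -- Expectation over one arrival

    prob-nonneg : ∀ a → 0# ≤ prob a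
    prob-nonneg (i , j) = *-nonneg (demand i) (supply j)
      where
      demand : ∀ i → 0# ≤ probᵈ i
      demand d₁ = 0≤α
      demand d₂ = x≤y⇒0≤y-x α≤1

      supply : ∀ j → 0# ≤ probˢ j
      supply s₁ = 0≤β
      supply s₂ = x≤y⇒0≤y-x β≤1

    -- Has the shape of one unfolding of `𝔼`, so that `𝔼 (suc n)` is definitionally a `mean`.
    mean : (Arrival → Carrier) → Carrier
    mean f = prob (d₁ , s₁) * f (d₁ , s₁) + prob (d₁ , s₂) * f (d₁ , s₂)
           + prob (d₂ , s₁) * f (d₂ , s₁) + prob (d₂ , s₂) * f (d₂ , s₂)

    mean-mono : ∀ {f g} → (∀ a → f a ≤ g a) → mean f ≤ mean g
    mean-mono {f} {g} f≤g =
      +-mono-≤ (+-mono-≤ (+-mono-≤ (term _) (term _)) (term _)) (term _)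
      where
      term : ∀ a → prob a * f a ≤ prob a * g a
      term a = *-monoˡ-≤-nonneg (prob-nonneg a) (f≤g a)

    mean-+ : ∀ f g → mean (λ a → f a + g a) ≈ mean f + mean g
    mean-+ f g =
      trans (+-cong (trans (+-cong (trans (+-cong (distribˡ _ _ _) (distribˡ _ _ _))
        (interchange _ _ _ _)) (distribˡ _ _ _))
        (interchange _ _ _ _)) (distribˡ _ _ _))
        (interchange _ _ _ _)

    mean-* : ∀ z f → mean (λ a → z * f a) ≈ z * mean f
    mean-* z f =
      trans (+-cong (trans (+-cong (trans (+-cong (comm _) (comm _))
        (sym (distribˡ _ _ _))) (comm _))
        (sym (distribˡ _ _ _))) (comm _))
        (sym (distribˡ _ _ _))
      where
      comm : ∀ a → prob a * (z * f a) ≈ z * (prob a * f a)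
      comm a = trans (sym (*-assoc (prob a) z (f a)))
        (trans (*-congʳ (*-comm (prob a) z)) (*-assoc z (prob a) (f a)))

    mean-const : ∀ x → mean (λ _ → x) ≈ x
    mean-const x = begin-equality
      prob (d₁ , s₁) * x + prob (d₁ , s₂) * x
        + prob (d₂ , s₁) * x + prob (d₂ , s₂) * x
        ≈⟨ +-assoc _ _ _ ⟩
      (prob (d₁ , s₁) * x + prob (d₁ , s₂) * x)
        + (prob (d₂ , s₁) * x + prob (d₂ , s₂) * x)
        ≈⟨ +-cong (supply α) (supply (1# - α)) ⟩
      α * x + (1# - α) * x
        ≈⟨ distribʳ x α (1# - α) ⟨
      (α + (1# - α)) * x
        ≈⟨ *-congʳ (total-prob α) ⟩
      1# * x
        ≈⟨ *-identityˡ x ⟩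
      x ∎
      where
      total-prob : ∀ p → p + (1# - p) ≈ 1#
      total-prob p = trans (+-comm p (1# - p)) (x-z+z≈x 1# p)

      supply : ∀ p → p * β * x + p * (1# - β) * x ≈ p * x
      supply p = begin-equality
        p * β * x + p * (1# - β) * x    ≈⟨ distribʳ x (p * β) (p * (1# - β)) ⟨
        (p * β + p * (1# - β)) * x      ≈⟨ *-congʳ (distribˡ p β (1# - β)) ⟨
        p * (β + (1# - β)) * x          ≈⟨ *-congʳ (*-congˡ (total-prob β)) ⟩
        p * 1# * x                      ≈⟨ *-congʳ (*-identityʳ p) ⟩
        p * x                           ∎

    mean-≤ : ∀ {f b} → (∀ a → f a ≤ b) → mean f ≤ b
    mean-≤ {f} {b} f≤b = ≤-respʳ-≈ (mean-const b) (mean-mono f≤b)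

    mean-convex : {f : Arrival → ℤ → Carrier} → (∀ a → Convex (f a)) →
      Convex (λ i → mean (λ a → f a i))
    mean-convex f-convex =
      convex-+ (convex-+ (convex-+ (term _) (term _)) (term _)) (term _)
      where
      term = λ a → convex-* (prob-nonneg a) (f-convex a)

    mean-↗ : {f : Arrival → ℕ → Carrier} {l : Arrival → Carrier} →
      (∀ a → f a ↗ l a) → (λ n → mean (λ a → f a n)) ↗ mean l
    mean-↗ f↗l = ↗-+ (↗-+ (↗-+ (term _) (term _)) (term _)) (term _)
      where
      term = λ a → ↗-* (prob-nonneg a) (f↗l a)

    -- Cost of residual queues

    cost-⊕ : ∀ v w → cost (v ⊕ w) ≈ cost v + cost w
    cost-⊕ v w =
      trans (+-cong (trans (+-cong (trans (+-cong (×-homo-+ _ (#d₁ v) _)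
        (×-homo-+ _ (#d₂ v) _)) (interchange _ _ _ _)) (×-homo-+ _ (#s₁ v) _))
        (interchange _ _ _ _)) (×-homo-+ _ (#s₂ v) _))
        (interchange _ _ _ _)

    -- κ i is the least cost of a queue with surplus i.
    κ : ℤ → Carrier
    κ i = cost (residual i)

    χ : Arrival → Carrier
    χ a = cost (e a)

    shift : Arrival → ℤ
    shift a = surplus (e a)

    κ-nonneg : ∀ i → 0# ≤ κ i
    κ-nonneg i = cost-nonneg (queue (residual i) (residual-balanced i))

    χ-nonneg : ∀ a → 0# ≤ χ a
    χ-nonneg a = cost-nonneg (queue (e a) (e-balanced a))

    κ0≈0 : κ (+ 0) ≈ 0#
    κ0≈0 = trans (+-identityʳ _) (trans (+-identityʳ _) (+-identityʳ 0#))

    -- The pairs above the residual form a balanced vector, whose cost is nonnegative.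
    κ≤cost : ∀ x → κ (surplus (items x)) ≤ cost (items x)
    κ≤cost x with items x | balanced⇒split (items x) (balanced x)
    ... | _ | split k l i = begin
      κ (surplus (vec k l k l ⊕ residual i))
        ≡⟨ ≡.cong κ (surplus-split k l i) ⟩
      κ i
        ≤⟨ x≤y+x (cost-nonneg (queue (vec k l k l) ≡.refl)) ⟩
      cost (vec k l k l) + κ i
        ≈⟨ cost-⊕ (vec k l k l) (residual i) ⟨
      cost (vec k l k l ⊕ residual i) ∎

    cost-exchange : ∀ v w v′ w′ → v ⊕ w ≡ v′ ⊕ w′ →
      cost v + cost w ≈ cost v′ + cost w′
    cost-exchange v w v′ w′ eq = trans (sym (cost-⊕ v w))
      (trans (reflexive (≡.cong cost eq)) (cost-⊕ v′ w′))

    -- `κ` is linear on each side of 0. At the kink the inequality reads 0 ≤ κ(-1) + κ(1), which is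
    -- nonnegativity of the cost.
    κ-convex : Convex κ
    κ-convex (+ n) = ≤-reflexive (cost-exchange
      (residual (+ suc n)) (residual (+ suc n))
      (residual (+ n)) (residual (+ suc (suc n)))
      (≡.cong (λ m → vec m 0 0 m) (≡.sym (ℕ.+-suc n (suc n)))))
    κ-convex -[1+ zero ] = begin
      κ (+ 0) + κ (+ 0)       ≈⟨ +-cong κ0≈0 κ0≈0 ⟩
      0# + 0#                 ≤⟨ +-mono-≤ (κ-nonneg -[1+ 0 ]) (κ-nonneg (+ 1)) ⟩
      κ -[1+ 0 ] + κ (+ 1)    ∎
    κ-convex -[1+ (suc zero) ] = ≤-reflexive (cost-exchange
      (residual -[1+ 0 ]) (residual -[1+ 0 ])
      (residual -[1+ 1 ]) (residual (+ 0)) ≡.refl)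
    κ-convex -[1+ (suc (suc n)) ] = ≤-reflexive (cost-exchange
      (residual -[1+ suc n ]) (residual -[1+ suc n ])
      (residual -[1+ suc (suc n) ]) (residual -[1+ n ])
      (≡.cong (λ m → vec 0 (suc (suc m)) (suc (suc m)) 0) (ℕ.+-suc n (suc n))))

    -- The Bellman operator and value iteration

    -- If J i is the cost to go after a matching that leaves residual i, then
    -- flatten J i is its minimum over the (1,2)-matchings available at surplus i.
    T : (ℤ → Carrier) → ℤ → Carrier
    T J i = mean (λ a → κ i + χ a + θ * flatten J (i ℤ.+ shift a))

    T-mono : ∀ {f g} → (∀ i → f i ≤ g i) → ∀ i → T f i ≤ T g i
    T-mono f≤g i = mean-mono λ a → +-monoʳ-≤ (κ i + χ a)
      (*-monoˡ-≤-nonneg 0≤θ (flatten-mono f≤g (i ℤ.+ shift a)))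

    T-nonneg : ∀ {f} → (∀ i → 0# ≤ f i) → ∀ i → 0# ≤ T f i
    T-nonneg {f} 0≤f i = begin
      0#
        ≈⟨ mean-const 0# ⟨
      mean (λ _ → 0#)
        ≤⟨ mean-mono (λ a → +-nonneg (+-nonneg (κ-nonneg i) (χ-nonneg a))
             (*-nonneg 0≤θ (≤-trans (flatten-const 0# (i ℤ.+ shift a))
               (flatten-mono 0≤f (i ℤ.+ shift a))))) ⟩
      T f i ∎

    T-↗ : {f : ℕ → ℤ → Carrier} {F : ℤ → Carrier} →
      (∀ i → (λ n → f n i) ↗ F i) → ∀ i → (λ n → T (f n) i) ↗ T F i
    T-↗ f↗F i = mean-↗ λ a →
      ↗-+ (↗-const (κ i + χ a)) (↗-* 0≤θ (flatten-↗ f↗F (i ℤ.+ shift a)))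

    -- The invariant of value iteration: convexity alone would not survive `flatten`, which also
    -- relies on the descent into 0.
    record Regular (f : ℤ → Carrier) : Set where
      field
        convex : Convex f
        f0≤f-1 : f (+ 0) ≤ f -[1+ 0 ]

      open Flatten convex f0≤f-1 public

    open Regular

    -- Convexity survives shifts and nonnegative combinations. The descent into 0 holds because `κ`
    -- vanishes at 0 and the flattened function is nonincreasing.
    T-regular : ∀ {f} → Regular f → Regular (T f)
    T-regular {f} f-regular = record
      { convex = mean-convex λ a →
          convex-+ (convex-+ κ-convex (convex-const (χ a)))
            (convex-* 0≤θ (convex-shift (shift a) (flatten-convex f-regular)))
      ; f0≤f-1 = mean-mono λ a →
          +-mono-≤ (+-monoˡ-≤ (χ a) (≤-respˡ-≈ (sym κ0≈0) (κ-nonneg -[1+ 0 ])))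
            (*-monoˡ-≤-nonneg 0≤θ (begin
              flatten f (+ 0 ℤ.+ shift a)
                ≡⟨ ≡.cong (flatten f) (ℤ.+-assoc ℤ.1ℤ -[1+ 0 ] (shift a)) ⟩
              flatten f (ℤ.suc (-[1+ 0 ] ℤ.+ shift a))
                ≤⟨ flatten-nonincreasing f-regular (-[1+ 0 ] ℤ.+ shift a) ⟩
              flatten f (-[1+ 0 ] ℤ.+ shift a) ∎))
      }

    -- Starting from 0, below all costs, makes the iterates increase.
    J : ℕ → ℤ → Carrier
    J zero    = λ _ → 0#
    J (suc n) = T (J n)

    J-regular : ∀ n → Regular (J n)
    J-regular zero    = record { convex = convex-const 0# ; f0≤f-1 = ≤-refl }
    J-regular (suc n) = T-regular (J-regular n)

    J-increasing : ∀ n i → J n i ≤ J (suc n) i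
    J-increasing zero    = T-nonneg λ _ → ≤-refl
    J-increasing (suc n) = T-mono (J-increasing n)

    -- A linear bound on the iterates

    ×-nonneg : ∀ n {x} → 0# ≤ x → 0# ≤ n ×ᴿ x
    ×-nonneg zero    0≤x = ≤-refl
    ×-nonneg (suc n) 0≤x = +-nonneg 0≤x (×-nonneg n 0≤x)

    ×-monoˡ-≤ : ∀ {x m n} → 0# ≤ x → m ℕ.≤ n → m ×ᴿ x ≤ n ×ᴿ x
    ×-monoˡ-≤ {n = n} 0≤x ℕ.z≤n       = ×-nonneg n 0≤x
    ×-monoˡ-≤         0≤x (ℕ.s≤s m≤n) = +-monoʳ-≤ _ (×-monoˡ-≤ 0≤x m≤n)

    M : Carrier
    M = χ (d₁ , s₁) + χ (d₁ , s₂) + χ (d₂ , s₁) + χ (d₂ , s₂)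

    0≤χ₁₁ = χ-nonneg (d₁ , s₁)
    0≤χ₁₂ = χ-nonneg (d₁ , s₂)
    0≤χ₂₁ = χ-nonneg (d₂ , s₁)
    0≤χ₂₂ = χ-nonneg (d₂ , s₂)

    M-nonneg : 0# ≤ M
    M-nonneg = +-nonneg (+-nonneg (+-nonneg 0≤χ₁₁ 0≤χ₁₂) 0≤χ₂₁) 0≤χ₂₂

    χ≤M : ∀ a → χ a ≤ M
    χ≤M (d₁ , s₁) = ≤-trans (≤-trans (x≤x+y 0≤χ₁₂) (x≤x+y 0≤χ₂₁)) (x≤x+y 0≤χ₂₂)
    χ≤M (d₁ , s₂) = ≤-trans (≤-trans (x≤y+x 0≤χ₁₁) (x≤x+y 0≤χ₂₁)) (x≤x+y 0≤χ₂₂)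
    χ≤M (d₂ , s₁) = ≤-trans (x≤y+x (+-nonneg 0≤χ₁₁ 0≤χ₁₂)) (x≤x+y 0≤χ₂₂)
    χ≤M (d₂ , s₂) = x≤y+x (+-nonneg (+-nonneg 0≤χ₁₁ 0≤χ₁₂) 0≤χ₂₁)

    -- A residual consists of |i| copies of the pair (1,2) or of the pair (2,1), each costing at
    -- most `M`.
    κ≤∣i∣×M : ∀ i → κ i ≤ ℤ.∣ i ∣ ×ᴿ M
    κ≤∣i∣×M (+ zero)    = ≤-reflexive κ0≈0
    κ≤∣i∣×M (+ (suc n)) = begin
      κ (+ suc n)          ≈⟨ cost-⊕ (residual (+ 1)) (residual (+ n)) ⟩
      κ (+ 1) + κ (+ n)    ≤⟨ +-mono-≤ (χ≤M (d₁ , s₂)) (κ≤∣i∣×M (+ n)) ⟩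
      M + n ×ᴿ M           ∎
    κ≤∣i∣×M -[1+ zero ]    = ≤-trans (χ≤M (d₂ , s₁)) (x≤x+y ≤-refl)
    κ≤∣i∣×M -[1+ (suc n) ] = begin
      κ -[1+ suc n ]             ≈⟨ cost-⊕ (residual -[1+ 0 ]) (residual -[1+ n ]) ⟩
      κ -[1+ 0 ] + κ -[1+ n ]    ≤⟨ +-mono-≤ (χ≤M (d₂ , s₁)) (κ≤∣i∣×M -[1+ n ]) ⟩
      M + suc n ×ᴿ M             ∎

    ∣i+shift∣≤ : ∀ i a → ℤ.∣ i ℤ.+ shift a ∣ ℕ.≤ suc ℤ.∣ i ∣
    ∣i+shift∣≤ i a = ℕ.≤-trans (ℤ.∣i+j∣≤∣i∣+∣j∣ i (shift a))
      (ℕ.≤-trans (ℕ.+-monoʳ-≤ ℤ.∣ i ∣ (∣shift∣≤1 a))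
        (ℕ.≤-reflexive (ℕ.+-comm ℤ.∣ i ∣ 1)))
      where
      ∣shift∣≤1 : ∀ a → ℤ.∣ shift a ∣ ℕ.≤ 1
      ∣shift∣≤1 (d₁ , s₁) = ℕ.z≤n
      ∣shift∣≤1 (d₁ , s₂) = ℕ.≤-refl
      ∣shift∣≤1 (d₂ , s₁) = ℕ.≤-refl
      ∣shift∣≤1 (d₂ , s₂) = ℕ.z≤n

    -- An arrival costs at most `M` and moves the surplus by at most one, which suggests a bound
    -- linear in |i|. The coefficients D = M / (1 - θ) and A = D / (1 - θ) close the inequality;
    -- monotonicity of `T` then puts all iterates below `B`.
    supersolution : ∃ λ (B : ℤ → Carrier) →
      (∀ i → 0# ≤ B i) × (∀ i → T B i ≤ B i)
    supersolution =
      let D , 0≤D , M+θD≈D = geometric 0≤θ θ<1 M-nonneg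
          A , 0≤A , D+θA≈A = geometric 0≤θ θ<1 0≤D
          B = λ i → ℤ.∣ i ∣ ×ᴿ D + A
      in B , (λ i → +-nonneg (×-nonneg ℤ.∣ i ∣ 0≤D) 0≤A) , λ i → mean-≤ λ a →
        let n = ℤ.∣ i ∣ in begin
        κ i + χ a + θ * flatten B (i ℤ.+ shift a)
          ≤⟨ +-mono-≤ (+-mono-≤ (κ≤∣i∣×M i) (χ≤M a))
               -- The running minimum is bounded by the choice of no (1,2)-match.
               (*-monoˡ-≤-nonneg 0≤θ (≤-trans (flatten≤ B (i ℤ.+ shift a))
                 (+-monoˡ-≤ A (×-monoˡ-≤ 0≤D (∣i+shift∣≤ i a))))) ⟩
        n ×ᴿ M + M + θ * (suc n ×ᴿ D + A)
          ≈⟨ +-cong (+-comm (n ×ᴿ M) M) (distribˡ θ (suc n ×ᴿ D) A) ⟩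
        suc n ×ᴿ M + (θ * (suc n ×ᴿ D) + θ * A)
          ≈⟨ +-assoc (suc n ×ᴿ M) (θ * (suc n ×ᴿ D)) (θ * A) ⟨
        suc n ×ᴿ M + θ * (suc n ×ᴿ D) + θ * A
          ≈⟨ +-congʳ (+-congˡ (×-comm-* (suc n) θ D)) ⟩
        suc n ×ᴿ M + suc n ×ᴿ (θ * D) + θ * A
          ≈⟨ +-congʳ (×-distrib-+ M (θ * D) (suc n)) ⟨
        suc n ×ᴿ (M + θ * D) + θ * A
          ≈⟨ +-congʳ (×-congʳ (suc n) M+θD≈D) ⟩
        D + n ×ᴿ D + θ * A
          ≈⟨ +-congʳ (+-comm D (n ×ᴿ D)) ⟩
        n ×ᴿ D + D + θ * A
          ≈⟨ +-assoc (n ×ᴿ D) D (θ * A) ⟩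
        n ×ᴿ D + (D + θ * A)
          ≈⟨ +-congˡ D+θA≈A ⟩
        n ×ᴿ D + A ∎

    J-converges : ∀ i → ∃ ((λ n → J n i) ↗_)
    J-converges i = ↗-sup (λ n → J-increasing n i) (λ n → J≤B n i)
      where
      B = proj₁ supersolution

      J≤B : ∀ n i → J n i ≤ B i
      J≤B zero    i = proj₁ (proj₂ supersolution) i
      J≤B (suc n) i = ≤-trans (T-mono (J≤B n) i) (proj₂ (proj₂ supersolution) i)

    -- The limit of value iteration

    J∞ : ℤ → Carrier
    J∞ i = proj₁ (J-converges i)

    J↗J∞ : ∀ i → (λ n → J n i) ↗ J∞ i
    J↗J∞ i = proj₂ (J-converges i)

    J∞-regular : Regular J∞
    J∞-regular = record
      { convex = convex-↗ {J} (λ n → convex (J-regular n)) J↗J∞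
      ; f0≤f-1 = least (J↗J∞ (+ 0)) _ λ n →
          ≤-trans (f0≤f-1 (J-regular n)) (upper (J↗J∞ -[1+ 0 ]) n)
      }

    flatten-J∞-nonneg : ∀ i → 0# ≤ flatten J∞ i
    flatten-J∞-nonneg i =
      ≤-trans (flatten-const 0# i) (flatten-mono (λ j → upper (J↗J∞ j) 0) i)

    -- `T` commutes with increasing limits, and `T (J n)` is the next iterate.
    TJ∞≤J∞ : ∀ i → T J∞ i ≤ J∞ i
    TJ∞≤J∞ i = least (T-↗ {J} J↗J∞ i) _ λ n → upper (J↗J∞ i) (suc n)

    -- Lower bound on the cost of every policy

    sum-mean : ∀ {N} (h : Fin N → Carrier) (g : Arrival → Fin N → Carrier) →
      sum (λ n → θ * h n * mean (λ a → g a n)) ≈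
      θ * mean (λ a → sum (λ n → h n * g a n))
    sum-mean {zero}  h g = sym (trans (*-congˡ (mean-const 0#)) (zeroʳ θ))
    sum-mean {suc N} h g = begin-equality
      θ * h n * mean (λ a → g a n) + sum {N} _
        ≈⟨ +-cong (*-assoc θ (h n) _)
             (sum-mean (λ m → h (Fin.suc m)) (λ a m → g a (Fin.suc m))) ⟩
      θ * (h n * mean (λ a → g a n)) + θ * mean S
        ≈⟨ distribˡ θ _ _ ⟨
      θ * (h n * mean (λ a → g a n) + mean S)
        ≈⟨ *-congˡ (+-congʳ (mean-* (h n) (λ a → g a n))) ⟨
      θ * (mean (λ a → h n * g a n) + mean S)
        ≈⟨ *-congˡ (mean-+ (λ a → h n * g a n) S) ⟨
      θ * mean (λ a → h n * g a n + S a) ∎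
      where
      n = Fin.zero
      S = λ a → sum (λ m → h (Fin.suc m) * g a (Fin.suc m))

    tail : Policy → Policy
    tail π n = π (suc n)

    -- Conditioning on the first arrival: the cost at time 0 is determined by `y`, and each later
    -- term gives up one factor `θ`.
    partialCost-suc : ∀ π y N → partialCost c θ π y (suc N) ≈
      stateCost c y + θ * mean (λ a → partialCost c θ (tail π) (step (π 0) y a) N)
    partialCost-suc π y N = +-cong (*-identityˡ (stateCost c y))
      (sum-mean {N} (λ n → θ ^ toℕ n)
        (λ a n → expectedCost c (tail π) (step (π 0) y a) (toℕ n)))

    -- Induction on the horizon, for an arbitrary first matching `u`: the queue it leaves costs at
    -- least `κ` of its surplus, and the induction hypothesis covers the rest of the policy.
    flatten-J≤partialCost : ∀ N π x u adm → flatten (J N) (surplus (items x)) ≤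
      mean (λ a → partialCost c θ π (remove x u adm , a) N)
    flatten-J≤partialCost zero π x u adm = begin
      flatten (J 0) (surplus (items x))  ≤⟨ flatten≤ (J 0) (surplus (items x)) ⟩
      0#                                 ≈⟨ mean-const 0# ⟨
      mean (λ _ → 0#)                    ∎
    flatten-J≤partialCost (suc N) π x u adm = begin
      flatten (J (suc N)) (surplus (items x))
        ≡⟨ ≡.cong (flatten (J (suc N))) (surplus-⊖ (items x) u (≤d₁ adm) (≤s₁ adm)) ⟩
      flatten (J (suc N)) (+ u₁₂ u ℤ.+ i)
        -- Without priority to (1,1) and (2,2), matches in (1,2) can even push the surplus below 0;
        -- monotonicity of the flattened iterate covers this case too.
        ≤⟨ nonincreasing-+ (flatten-nonincreasing (J-regular (suc N))) (u₁₂ u) i ⟩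
      flatten (J (suc N)) i
        ≤⟨ flatten≤ (J (suc N)) i ⟩
      T (J N) i
        ≤⟨ mean-mono (λ a → let x′ = arrive (q , a); u′ , adm′ = π 0 x′ in begin
             κ i + χ a + θ * flatten (J N) (i ℤ.+ shift a)
               ≡⟨ ≡.cong (λ j → κ i + χ a + θ * flatten (J N) j)
                    (surplus-⊕ (items q) (e a)) ⟨
             κ i + χ a + θ * flatten (J N) (surplus (items x′))
               ≤⟨ +-mono-≤ (+-monoˡ-≤ (χ a) (κ≤cost q))
                    (*-monoˡ-≤-nonneg 0≤θ (flatten-J≤partialCost N (tail π) x′ u′ adm′)) ⟩
             cost (items q) + χ a + θ * _
               ≈⟨ +-congʳ (cost-⊕ (items q) (e a)) ⟨
             cost (items x′) + θ * _
               ≈⟨ partialCost-suc π (q , a) N ⟨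
             partialCost c θ π (q , a) (suc N) ∎) ⟩
      mean (λ a → partialCost c θ π (q , a) (suc N)) ∎
      where
      q = remove x u adm
      i = surplus (items q)

    -- The threshold policy attains the bound

    threshold : ℕ ⁺
    threshold = proj₁ (optimalThreshold J∞-regular)

    δ : DecisionRule
    δ = thresholdRule threshold

    act : Queue → Queue
    act x = let u , adm = δ x in remove x u adm

    -- Induction on the horizon. The threshold rule leaves a residual, so the stage cost is
    -- `κ j + χ a` exactly; `TJ∞≤J∞` absorbs one stage, and the choice of threshold places `J∞ j`
    -- below the running minimum.
    partialCost≤flatten-J∞ : ∀ N x →
      mean (λ a → partialCost c θ (stationary δ) (act x , a) N) ≤
      flatten J∞ (surplus (items x))
    partialCost≤flatten-J∞ zero x = mean-≤ λ _ → flatten-J∞-nonneg (surplus (items x))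
    partialCost≤flatten-J∞ (suc N) x = begin
      mean (λ a → partialCost c θ (stationary δ) (act x , a) (suc N))
        ≤⟨ mean-mono (λ a → let x′ = arrive (act x , a) in begin
             partialCost c θ (stationary δ) (act x , a) (suc N)
               ≈⟨ partialCost-suc (stationary δ) (act x , a) N ⟩
             cost (items x′) + θ * _
               ≤⟨ +-monoʳ-≤ _ (*-monoˡ-≤-nonneg 0≤θ (partialCost≤flatten-J∞ N x′)) ⟩
             cost (items x′) + θ * flatten J∞ (surplus (items x′))
               ≈⟨ +-congʳ (cost-⊕ (items (act x)) (e a)) ⟩
             cost (items (act x)) + χ a + θ * flatten J∞ (surplus (items x′))
               ≡⟨ ≡.cong (λ j → cost (items (act x)) + χ a + θ * flatten J∞ j)
                    (surplus-⊕ (items (act x)) (e a)) ⟩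
             cost (items (act x)) + χ a
               + θ * flatten J∞ (surplus (items (act x)) ℤ.+ shift a)
               ≡⟨ ≡.cong (λ v → cost v + χ a + θ * flatten J∞ (surplus v ℤ.+ shift a))
                    (threshold-residual threshold (balanced⇒split (items x) (balanced x))) ⟩
             κ j + χ a + θ * flatten J∞ (surplus (residual j) ℤ.+ shift a)
               ≡⟨ ≡.cong (λ i → κ j + χ a + θ * flatten J∞ (i ℤ.+ shift a))
                    (surplus-residual j) ⟩
             κ j + χ a + θ * flatten J∞ (j ℤ.+ shift a) ∎) ⟩
      T J∞ j
        ≤⟨ TJ∞≤J∞ j ⟩
      J∞ j
        ≤⟨ proj₂ (optimalThreshold J∞-regular) (surplus (items x)) ⟩
      flatten J∞ (surplus (items x)) ∎
      where
      j = clamp threshold (surplus (items x))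

    optimal : ∃ λ (δ : DecisionRule) → ThresholdType δ × (∀ (y : State) →
      ∃ λ (v : Carrier) →
        IsDiscountedCost c θ (stationary δ) y v × IsOptimalCost c θ y v)
    optimal = δ , (threshold , λ _ → ≡.refl) , λ y →
      let x = arrive y
          i = surplus (items x)

          -- The first cost is incurred before any decision, hence the separate term ahead of the
          -- discounted remainder.
          iterates↗ : (λ n → cost (items x) + θ * flatten (J n) i) ↗
                      cost (items x) + θ * flatten J∞ i
          iterates↗ = ↗-+ (↗-const (cost (items x))) (↗-* 0≤θ (flatten-↗ {J} J↗J∞ i))

          iterates≤ : ∀ π n → cost (items x) + θ * flatten (J n) i ≤
                      partialCost c θ π y (suc n)
          iterates≤ π n = begin
            cost (items x) + θ * flatten (J n) i
              ≤⟨ +-monoʳ-≤ _ (*-monoˡ-≤-nonneg 0≤θ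
                   (flatten-J≤partialCost n (tail π) x (proj₁ (π 0 x)) (proj₂ (π 0 x)))) ⟩
            cost (items x) + θ * _
              ≈⟨ partialCost-suc π y n ⟨
            partialCost c θ π y (suc n) ∎

          ≤limit : ∀ n → partialCost c θ (stationary δ) y n ≤
                   cost (items x) + θ * flatten J∞ i
          ≤limit = λ where
            zero    → +-nonneg (cost-nonneg x) (*-nonneg 0≤θ (flatten-J∞-nonneg i))
            (suc n) → begin
              partialCost c θ (stationary δ) y (suc n)
                ≈⟨ partialCost-suc (stationary δ) y n ⟩
              cost (items x) + θ * _
                ≤⟨ +-monoʳ-≤ _ (*-monoˡ-≤-nonneg 0≤θ (partialCost≤flatten-J∞ n x)) ⟩
              cost (items x) + θ * flatten J∞ i ∎

          discounted = squeeze-limit iterates↗ (iterates≤ (stationary δ)) ≤limit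
      in _ , discounted
           -- The value is a lower bound by the iterates, and the greatest one because the threshold
           -- policy attains it.
           , (λ w (π , π→w) → limit-dominates iterates↗ (iterates≤ π) π→w)
           , (λ b b≤ → b≤ _ (stationary δ , discounted))

theorem5 : ExcludedMiddle 0ℓ →
  (ℝ : CompleteOrderedField) →
  let open Discounted ℝ in
  (α β : Carrier) →
  0# < α → α < 1# → 0# < β → β < 1# → β < α →
  (c : NodeVec Carrier) →
  (∀ (q : Queue) → 0# ≤ linearCost c (items q)) →
  (θ : Carrier) → 0# ≤ θ → θ < 1# →
  let open Arrivals α β in
  ∃ λ (δ : DecisionRule) →
    ThresholdType δ ×
    (∀ (y : State) →
      ∃ λ (v : Carrier) →
        IsDiscountedCost c θ (stationary δ) y v × IsOptimalCost c θ y v)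
theorem5 em ℝ α β (0≤α , _) (α≤1 , _) (0≤β , _) (β≤1 , _) _
         c cost-nonneg θ 0≤θ θ<1 =
  Model.optimal α β 0≤α α≤1 0≤β β≤1 c cost-nonneg θ 0≤θ θ<1
  where open DiscountedMatching em ℝ
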